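{- Let $r>1$ be an integer and let $p_1=2<p_2<\cdots<p_r$ be distinct primes. Then there are positive integers $\alpha_1,\ldots,\alpha_r$ such that $p_1^{\alpha_1}\cdots p_r^{\alpha_r}$ is a covering number.
   Context: For $a\in\mathbb{Z}$ and a positive integer $n$, $a(\mathrm{mod}\ n)=\{a+nx: x\in\mathbb{Z}\}$ is the residue class with modulus $n$. A finite system of residue classes $\{a_i(\mathrm{mod}\ n_i)\}_{i=1}^k$ is a cover of $\mathbb{Z}$ if every integer lies in at least one of the classes $a_i(\mathrm{mod}\ n_i)$. A positive integer $n$ is called a covering number if there is a cover of $\mathbb{Z}$ whose moduli are all distinct, greater than one, and divisors of $n$. -}

module Defs where

open import Data.Fin using (Fin)
open import Data.Integer using (ℤ; +_)
import Data.Integer as ℤ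
open import Data.Nat using (ℕ; _*_; _<_; NonZero)
open import Data.Nat.Divisibility using (_∣_)
open import Data.Product using (Σ; ∃; _×_)
open import Data.Vec.Functional using (Vector; foldr)
open import Function using (_∘_)
open import Function.Definitions using (Injective)
open import Relation.Binary.PropositionalEquality using (_≡_)
open import Relation.Unary using (Pred; _∈_)
import Level

record ResidueClass : Set where
  constructor _mod_
  field
    residue : ℤ
    modulus : ℕ
    .{{modulus≢0}} : NonZero modulus

open ResidueClass public

⟦_⟧ : ResidueClass → Pred ℤ Level.zero
⟦ C ⟧ y = ∃ λ (x : ℤ) → y ≡ residue C ℤ.+ + modulus C ℤ.* x

IsCover : ∀ {k} → Vector ResidueClass k → Set
IsCover C = ∀ (y : ℤ) → ∃ λ i → y ∈ ⟦ C i ⟧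

CoveringNumber : ℕ → Set
CoveringNumber n =
  0 < n ×
  Σ ℕ λ k → Σ (Vector ResidueClass k) λ C →
    IsCover C ×
    Injective _≡_ _≡_ (modulus ∘ C) ×
    (∀ i → 1 < modulus (C i)) ×
    (∀ i → modulus (C i) ∣ n)

∏ : ∀ {r} → Vector ℕ r → ℕ
∏ = foldr _*_ 1

{-# OPTIONS --safe #-}

-- With a single odd prime q = m + 1, the number 2 ^ m * q is already a covering number.
-- The classes 2^i (mod 2^(i+1)), i < m, leave exactly the multiples 2^m w uncovered.
-- Dividing w by q with remainder i puts 2^m w in the class i 2^m (mod 2^i q),
-- because 2^i divides 2^m for every remainder i ≤ m.
module Submission where

open import Defs
open import Data.Nat using (ℕ; zero; suc; _+_; _*_; _≤_; _<_; _^_; NonZero; z≤n; z<s; s≤s; s≤s⁻¹; >-nonZero⁻¹)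
open import Data.Nat.Properties
  using (<⇒≤; <-cmp; <⇒≢; <⇒≱; <-≤-trans; n<1+n; m<n⇒m<1+n; m≤n*m; *-cancelʳ-≡; suc-injective
        ; m^n≢0; m*n≢0; ^-monoʳ-<; ^-monoʳ-≤; *-identityʳ)
open import Data.Nat.Divisibility using (_∣_; divides; ∣⇒≤; ∣-trans; m∣m*n; *-monoʳ-∣; *-monoˡ-∣)
open import Data.Nat.Primality using (Prime; euclidsLemma; prime⇒nonZero)
open import Data.Integer using (ℤ; +_)
import Data.Integer as ℤ
open import Data.Integer.DivMod using (_/ℕ_; _%ℕ_; n%ℕd<d; a≡a%ℕn+[a/ℕn]*n)
import Data.Integer.Properties as ℤₚ
open import Data.Integer.Tactic.RingSolver using (solve-∀)
open import Data.Fin using (Fin; zero; suc; toℕ; fromℕ<; splitAt; join) renaming (_<_ to _<ᶠ_)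
open import Data.Fin.Properties using (toℕ<n; toℕ-fromℕ<; toℕ-injective; splitAt-join; join-splitAt)
open import Data.Product using (Σ; ∃; _×_; _,_)
open import Data.Sum using (_⊎_; inj₁; inj₂; [_,_]′; map₁)
open import Function using (_∘_; id)
open import Function.Definitions using (Injective)
open import Relation.Binary.Definitions using (tri<; tri≈; tri>)
open import Relation.Binary.PropositionalEquality
  using (_≡_; _≢_; refl; sym; trans; cong; subst; module ≡-Reasoning)
open import Relation.Nullary using (contradiction)
open import Relation.Unary using (_∈_)

^-injectiveʳ : ∀ b → 1 < b → Injective _≡_ _≡_ (b ^_)
^-injectiveʳ b 1<b {m} {n} eq with <-cmp m n
... | tri< m<n _ _ = contradiction eq (<⇒≢ (^-monoʳ-< b 1<b m<n))
... | tri≈ _ m≡n _ = m≡n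
... | tri> _ _ n<m = contradiction (sym eq) (<⇒≢ (^-monoʳ-< b 1<b n<m))

^-monoʳ-∣ : ∀ b {m n} → m ≤ n → b ^ m ∣ b ^ n
^-monoʳ-∣ b {n = n} z≤n = divides (b ^ n) (sym (*-identityʳ (b ^ n)))
^-monoʳ-∣ b (s≤s m≤n) = *-monoʳ-∣ b (^-monoʳ-∣ b m≤n)

prime∣^⇒∣ : ∀ {p} → Prime p → ∀ b n → p ∣ b ^ n → p ∣ b
prime∣^⇒∣ pp b zero    p∣1  = ∣-trans p∣1 (divides b (sym (*-identityʳ b)))
prime∣^⇒∣ pp b (suc n) p∣bb = [ id , prime∣^⇒∣ pp b n ]′ (euclidsLemma b (b ^ n) pp p∣bb)

∏≢0 : ∀ {r} (f : Fin r → ℕ) → (∀ i → NonZero (f i)) → NonZero (∏ f)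
∏≢0 {zero}  f nz = _
∏≢0 {suc r} f nz = m*n≢0 (f zero) (∏ (f ∘ suc)) {{nz zero}} {{∏≢0 (f ∘ suc) (nz ∘ suc)}}

-- The same cover serves `n`. This absorbs all primes after the second.
CoveringNumber-∣ : ∀ {m n} → m ∣ n → 0 < n → CoveringNumber m → CoveringNumber n
CoveringNumber-∣ m∣n 0<n (_ , k , C , cover , distinct , >1 , ∣m) =
  0<n , k , C , cover , distinct , >1 , λ i → ∣-trans (∣m i) m∣n

dyadicClass : ℕ → ResidueClass
dyadicClass i = _mod_ (+ (2 ^ i)) (2 ^ suc i) {{m^n≢0 2 (suc i)}}

-- Induction on `m`, reading off binary digits: if `y` is `2 ^ n` times `w`, an odd `w` puts `y` in
-- `dyadicClass n`, and an even `w` supplies one more factor 2.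
dyadic-cover : ∀ m (y : ℤ) →
  (Σ (Fin m) λ i → y ∈ ⟦ dyadicClass (toℕ i) ⟧) ⊎ (∃ λ w → y ≡ + (2 ^ m) ℤ.* w)
dyadic-cover m y = map₁
  -- `go` keeps a natural index with a bound, which only has to be weakened as `n` grows; it becomes
  -- a `Fin m` once, here.
  (λ (i , i<m , y∈) → fromℕ< i<m , subst (λ j → y ∈ ⟦ dyadicClass j ⟧) (sym (toℕ-fromℕ< i<m)) y∈)
  (go m)
  where
  open ≡-Reasoning

  -- The summand `+ 0` is the remainder, in the shape that division by 2 delivers it.
  even : ∀ a d → a ℤ.* (+ 0 ℤ.+ d ℤ.* + 2) ≡ (+ 2 ℤ.* a) ℤ.* d
  even = solve-∀

  odd : ∀ a d → a ℤ.* (+ 1 ℤ.+ d ℤ.* + 2) ≡ a ℤ.+ (+ 2 ℤ.* a) ℤ.* d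
  odd = solve-∀

  go : ∀ n → (∃ λ i → i < n × y ∈ ⟦ dyadicClass i ⟧) ⊎ (∃ λ w → y ≡ + (2 ^ n) ℤ.* w)
  go zero = inj₂ (y , sym (ℤₚ.*-identityˡ y))
  go (suc n) with go n
  ... | inj₁ (i , i<n , y∈) = inj₁ (i , m<n⇒m<1+n i<n , y∈)
  ... | inj₂ (w , y≡) with w %ℕ 2 | n%ℕd<d w 2 | a≡a%ℕn+[a/ℕn]*n w 2
  ...   | 0 | _ | w≡ = inj₂ (w /ℕ 2 , (begin
          y                                            ≡⟨ trans y≡ (cong (+ (2 ^ n) ℤ.*_) w≡) ⟩
          + (2 ^ n) ℤ.* (+ 0 ℤ.+ (w /ℕ 2) ℤ.* + 2)     ≡⟨ even (+ (2 ^ n)) (w /ℕ 2) ⟩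
          (+ 2 ℤ.* + (2 ^ n)) ℤ.* (w /ℕ 2)             ≡⟨ cong (ℤ._* (w /ℕ 2)) (ℤₚ.pos-* 2 (2 ^ n)) ⟨
          + (2 ^ suc n) ℤ.* (w /ℕ 2)                   ∎))
  ...   | 1 | _ | w≡ = inj₁ (n , n<1+n n , w /ℕ 2 , (begin
          y                                            ≡⟨ trans y≡ (cong (+ (2 ^ n) ℤ.*_) w≡) ⟩
          + (2 ^ n) ℤ.* (+ 1 ℤ.+ (w /ℕ 2) ℤ.* + 2)     ≡⟨ odd (+ (2 ^ n)) (w /ℕ 2) ⟩
          + (2 ^ n) ℤ.+ (+ 2 ℤ.* + (2 ^ n)) ℤ.* (w /ℕ 2)
            ≡⟨ cong (λ t → + (2 ^ n) ℤ.+ t ℤ.* (w /ℕ 2)) (ℤₚ.pos-* 2 (2 ^ n)) ⟨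
          + (2 ^ n) ℤ.+ + (2 ^ suc n) ℤ.* (w /ℕ 2)     ∎))
  ...   | suc (suc _) | s≤s (s≤s ()) | _

module _ (m : ℕ) where

  -- The modulus `2 ^ m * suc m` would also do for each remainder `i`, but would repeat. Lowering
  -- the exponent to `i` makes the moduli distinct; the `suc m` remainders use up exactly the
  -- exponents from 0 to `m`.
  mixedClass : ℕ → ResidueClass
  mixedClass i = _mod_ (+ i ℤ.* + (2 ^ m)) (2 ^ i * suc m) {{m*n≢0 (2 ^ i) (suc m) {{m^n≢0 2 i}}}}

  mixed-cover : ∀ w → Σ (Fin (suc m)) λ i → + (2 ^ m) ℤ.* w ∈ ⟦ mixedClass (toℕ i) ⟧
  mixed-cover w with w %ℕ suc m | n%ℕd<d w (suc m) | a≡a%ℕn+[a/ℕn]*n w (suc m)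
  ... | i | i<q | w≡ = fromℕ< i<q , subst (λ j → + (2 ^ m) ℤ.* w ∈ ⟦ mixedClass j ⟧) (sym (toℕ-fromℕ< i<q)) w∈
    where
    open ≡-Reasoning
    d = w /ℕ suc m

    rearrange : ∀ e a i d q → (e ℤ.* a) ℤ.* (i ℤ.+ d ℤ.* q) ≡ i ℤ.* (e ℤ.* a) ℤ.+ (a ℤ.* q) ℤ.* (e ℤ.* d)
    rearrange = solve-∀

    w∈ : + (2 ^ m) ℤ.* w ∈ ⟦ mixedClass i ⟧
    -- As `i ≤ m`, there is `e` with `2 ^ m ≡ e * 2 ^ i`. The difference of `2 ^ m` times `w` and
    -- the residue is `2 ^ m` times `d * suc m`, that is, the modulus times `e * d`.
    w∈ with ^-monoʳ-∣ 2 (s≤s⁻¹ i<q)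
    ... | divides e 2^m≡ = + e ℤ.* d , (begin
      + (2 ^ m) ℤ.* w                                     ≡⟨ cong (+ (2 ^ m) ℤ.*_) w≡ ⟩
      + (2 ^ m) ℤ.* (+ i ℤ.+ d ℤ.* + suc m)               ≡⟨ cong (ℤ._* (+ i ℤ.+ d ℤ.* + suc m)) 2^m≡ℤ ⟩
      (+ e ℤ.* + (2 ^ i)) ℤ.* (+ i ℤ.+ d ℤ.* + suc m)     ≡⟨ rearrange (+ e) (+ (2 ^ i)) (+ i) d (+ suc m) ⟩
      + i ℤ.* (+ e ℤ.* + (2 ^ i)) ℤ.+ (+ (2 ^ i) ℤ.* + suc m) ℤ.* (+ e ℤ.* d)
        ≡⟨ cong (λ t → + i ℤ.* t ℤ.+ (+ (2 ^ i) ℤ.* + suc m) ℤ.* (+ e ℤ.* d)) 2^m≡ℤ ⟨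
      + i ℤ.* + (2 ^ m) ℤ.+ (+ (2 ^ i) ℤ.* + suc m) ℤ.* (+ e ℤ.* d)
        ≡⟨ cong (λ t → + i ℤ.* + (2 ^ m) ℤ.+ t ℤ.* (+ e ℤ.* d)) (ℤₚ.pos-* (2 ^ i) (suc m)) ⟨
      + i ℤ.* + (2 ^ m) ℤ.+ + (2 ^ i * suc m) ℤ.* (+ e ℤ.* d) ∎)
      where
      2^m≡ℤ : + (2 ^ m) ≡ + e ℤ.* + (2 ^ i)
      2^m≡ℤ = trans (cong +_ 2^m≡) (ℤₚ.pos-* e (2 ^ i))

  -- The sum keeps the two families apart for case analysis; `splitAt m` later turns it into one
  -- finite index.
  class : Fin m ⊎ Fin (suc m) → ResidueClass
  class = [ dyadicClass ∘ toℕ , mixedClass ∘ toℕ ]′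

  class-cover : ∀ y → ∃ λ s → y ∈ ⟦ class s ⟧
  class-cover y with dyadic-cover m y
  ... | inj₁ (i , y∈) = inj₁ i , y∈
  ... | inj₂ (w , refl) = let (i , y∈) = mixed-cover w in inj₂ i , y∈

  class-modulus∣ : ∀ s → modulus (class s) ∣ 2 ^ m * suc m
  class-modulus∣ (inj₁ i) = ∣-trans (^-monoʳ-∣ 2 (toℕ<n i)) (m∣m*n (suc m))
  class-modulus∣ (inj₂ i) = *-monoˡ-∣ (suc m) (^-monoʳ-∣ 2 (s≤s⁻¹ (toℕ<n i)))

  module _ (pp : Prime (suc m)) (2<q : 2 < suc m) where

    -- Otherwise the prime `suc m` would divide a power of 2, hence 2, although it exceeds 2. This
    -- separates the mixed moduli from the dyadic ones.
    2^i*q≢2^j : ∀ i j → 2 ^ i * suc m ≢ 2 ^ j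
    2^i*q≢2^j i j eq = <⇒≱ 2<q (∣⇒≤ (prime∣^⇒∣ pp 2 j (divides (2 ^ i) (sym eq))))

    class-modulus>1 : ∀ s → 1 < modulus (class s)
    class-modulus>1 (inj₁ i) = ^-monoʳ-≤ 2 {1} {suc (toℕ i)} (s≤s z≤n)
    -- The bound comes from the factor `suc m`, since the power of 2 is 1 at index 0.
    class-modulus>1 (inj₂ i) = <-≤-trans (<⇒≤ 2<q) (m≤n*m (suc m) (2 ^ toℕ i) {{m^n≢0 2 (toℕ i)}})

    class-modulus-injective : Injective _≡_ _≡_ (modulus ∘ class)
    class-modulus-injective {inj₁ i} {inj₁ j} eq =
      cong inj₁ (toℕ-injective (suc-injective (^-injectiveʳ 2 (n<1+n 1) eq)))
    class-modulus-injective {inj₁ i} {inj₂ j} eq = contradiction (sym eq) (2^i*q≢2^j (toℕ j) (suc (toℕ i)))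
    class-modulus-injective {inj₂ i} {inj₁ j} eq = contradiction eq (2^i*q≢2^j (toℕ i) (suc (toℕ j)))
    class-modulus-injective {inj₂ i} {inj₂ j} eq =
      cong inj₂ (toℕ-injective (^-injectiveʳ 2 (n<1+n 1) (*-cancelʳ-≡ (2 ^ toℕ i) (2 ^ toℕ j) (suc m) eq)))

    coveringNumber-2^m*q : CoveringNumber (2 ^ m * suc m)
    coveringNumber-2^m*q =
      >-nonZero⁻¹ _ {{m*n≢0 (2 ^ m) (suc m) {{m^n≢0 2 m}}}} ,
      m + suc m , class ∘ splitAt m ,
      (λ y → let (s , y∈) = class-cover y in
        join m (suc m) s , subst (λ t → y ∈ ⟦ class t ⟧) (sym (splitAt-join m (suc m) s)) y∈) ,
      splitAt-injective ∘ class-modulus-injective ,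
      class-modulus>1 ∘ splitAt m ,
      class-modulus∣ ∘ splitAt m
      where
      splitAt-injective : Injective _≡_ _≡_ (splitAt m {suc m})
      splitAt-injective {i} {j} eq =
        trans (sym (join-splitAt m (suc m) i)) (trans (cong (join m (suc m)) eq) (join-splitAt m (suc m) j))

corollary1p1 : (r : ℕ) (1<r : 1 < r) (p : Fin r → ℕ) →
    (∀ i → Prime (p i)) →
    p (fromℕ< (<⇒≤ 1<r)) ≡ 2 →
    (∀ {i j} → i <ᶠ j → p i < p j) →
    Σ (Fin r → ℕ) λ α →
    (∀ i → 0 < α i) ×
    CoveringNumber (∏ (λ i → p i ^ α i))
corollary1p1 (suc (suc r)) 1<r@(s≤s (s≤s _)) p prime p₁≡2 mono =
  -- The second prime is passed as a variable with an equation, so that it can be matched as `suc m`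
  -- and its predecessor used as the exponent of 2.
  covering (p (suc zero)) refl
  where
  covering : ∀ q → p (suc zero) ≡ q → Σ (Fin (2 + r) → ℕ) λ α →
    (∀ i → 0 < α i) × CoveringNumber (∏ (λ i → p i ^ α i))
  covering zero    p₂≡q = contradiction (subst (p zero <_) p₂≡q (mono z<s)) λ ()
  covering (suc m) p₂≡q =
    α , α>0 , CoveringNumber-∣ divisor (>-nonZero⁻¹ _ {{∏≢0 _ λ i → m^n≢0 (p i) (α i) {{prime⇒nonZero (prime i)}}}})
      (coveringNumber-2^m*q m q-prime 2<q)
    where
    α : Fin (2 + r) → ℕ
    α zero    = m
    α (suc _) = 1

    q-prime : Prime (suc m)
    q-prime = subst Prime p₂≡q (prime (suc zero))

    2<q : 2 < suc m
    2<q = subst (_< suc m) p₁≡2 (subst (p zero <_) p₂≡q (mono z<s))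

    α>0 : ∀ i → 0 < α i
    α>0 zero    = <⇒≤ (s≤s⁻¹ 2<q)
    α>0 (suc _) = z<s

    rest : ℕ
    rest = ∏ (λ (i : Fin r) → p (suc (suc i)) ^ 1)

    divisor : 2 ^ m * suc m ∣ ∏ (λ i → p i ^ α i)
    -- The product unfolds to `2 ^ m * ((suc m * 1) * rest)`, where the factor 1 comes from the
    -- exponent 1 of the second prime.
    divisor rewrite p₁≡2 | p₂≡q = *-monoʳ-∣ (2 ^ m) (∣-trans (m∣m*n 1) (m∣m*n rest))
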